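{- For any integer $\gamma \geq 0$ and any $\gamma$-multiprojection algebra $\mathcal{M}$ with operations $\star_a$ and endomorphisms $\pi_a$, $a \in [\gamma]$, the vector space $\mathcal{M}$ endowed with the bilinear operations $\dashv_a$, $\vdash_a$, $a \in [\gamma]$, defined for all $x, y \in \mathcal{M}$ by $$x \dashv_a y := x \star_a \pi_a(y), \qquad x \vdash_a y := \pi_a(x) \star_a y,$$ is a $\gamma$-pluriassociative algebra.
   Context: The ground field has characteristic zero; $[\gamma]=\{1,\dots,\gamma\}$ and $a \uparrow a' := \max(a,a')$. A $\gamma$-multiassociative algebra is a vector space $\mathcal{M}$ with bilinear operations $\star_a$, $a \in [\gamma]$, such that for all $x,y,z \in \mathcal{M}$, all $b \in [\gamma]$ and all $a, a', a'', a''' \in [\gamma]$ that are $\leq b$: $(x \star_a y) \star_b z = (x \star_b y) \star_{a'} z = x \star_{a''} (y \star_b z) = x \star_b (y \star_{a'''} z)$. A morphism of $\gamma$-multiassociative algebras is a linear map commuting with all operations $\star_a$. A $\gamma$-multiprojection algebra is a $\gamma$-multiassociative algebra $\mathcal{M}$ endowed with ($\gamma$-multiassociative algebra) endomorphisms $\pi_a : \mathcal{M} \to \mathcal{M}$, $a \in [\gamma]$, satisfying $\pi_a \circ \pi_{a'} = \pi_{a \uparrow a'}$ for all $a, a' \in [\gamma]$. A $\gamma$-pluriassociative algebra is a vector space with bilinear operations $\dashv_a, \vdash_a$, $a \in [\gamma]$, such that for all elements $x,y,z$ and all $a, a' \in [\gamma]$: $(x \vdash_{a'} y) \dashv_a z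 = x \vdash_{a'} (y \dashv_a z)$; $(x \dashv_{a\uparrow a'} y) \dashv_a z = x \dashv_a (y \vdash_{a'} z)$; $(x \dashv_{a'} y) \vdash_a z = x \vdash_a (y \vdash_{a \uparrow a'} z)$; $(x \dashv_a y) \dashv_{a\uparrow a'} z = x \dashv_a (y \dashv_{a'} z)$; $(x \vdash_{a'} y) \vdash_a z = x \vdash_{a \uparrow a'} (y \vdash_a z)$. -}

module Defs where

open import Algebra.Apartness.Bundles using (HeytingCommutativeRing; HeytingField)
open import Algebra.Bundles using (CommutativeRing)
open import Algebra.Module.Bundles using (Module)
open import Algebra.Module.Morphism.Structures using (IsModuleHomomorphism)
import Algebra.Construct.NaturalChoice.Max as Max
import Algebra.Definitions.RawMonoid as RawMonoidDefs
open import Data.Fin.Base using (Fin; _≤_)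
open import Data.Fin.Properties using (≤-totalOrder)
open import Data.Nat.Base using (ℕ; suc)
open import Data.Product.Base using (_×_)
open import Level using (Level; _⊔_) renaming (suc to lsuc)
open import Relation.Nullary.Negation using (¬_)

private
  variable
    k ℓ₁ ℓ₂ m ℓm n ℓn : Level

fieldRing : HeytingField k ℓ₁ ℓ₂ → CommutativeRing k ℓ₁
fieldRing K =
  HeytingCommutativeRing.commutativeRing (HeytingField.heytingCommutativeRing K)

CharacteristicZero : HeytingField k ℓ₁ ℓ₂ → Set ℓ₁
CharacteristicZero K = ∀ (n : ℕ) → ¬ (suc n · 1# ≈ 0#)
  where
  open HeytingField K using (_≈_; 0#; 1#)
  open RawMonoidDefs (CommutativeRing.+-rawMonoid (fieldRing K))
    using () renaming (_×_ to _·_)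

VectorSpace : HeytingField k ℓ₁ ℓ₂ → (m ℓm : Level) → Set (k ⊔ ℓ₁ ⊔ lsuc (m ⊔ ℓm))
VectorSpace K m ℓm = Module (fieldRing K) m ℓm

-- The index set [γ] = {1,…,γ} is Fin γ, with i : Fin γ standing for toℕ i + 1;
-- only the order of the indices matters, and this shift preserves it.

infixl 6 _↑_

_↑_ : ∀ {γ : ℕ} → Fin γ → Fin γ → Fin γ
_↑_ {γ} = Max._⊔_ (≤-totalOrder γ)

module _ {K : HeytingField k ℓ₁ ℓ₂} where

  IsLinear : (V : VectorSpace K m ℓm) (W : VectorSpace K n ℓn) →
             (Module.Carrierᴹ V → Module.Carrierᴹ W) → Set (k ⊔ m ⊔ ℓm ⊔ ℓn)
  IsLinear V W f = IsModuleHomomorphism (Module.rawModule V) (Module.rawModule W) f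

  module _ (V : VectorSpace K m ℓm) where
    open Module V using (Carrierᴹ; _≈ᴹ_)

    record IsBilinear (_∙_ : Carrierᴹ → Carrierᴹ → Carrierᴹ) : Set (k ⊔ m ⊔ ℓm) where
      field
        linearˡ : ∀ y → IsLinear V V (λ x → x ∙ y)
        linearʳ : ∀ x → IsLinear V V (λ y → x ∙ y)

    record IsMultiassociative (γ : ℕ)
             (_⋆[_]_ : Carrierᴹ → Fin γ → Carrierᴹ → Carrierᴹ) : Set (k ⊔ m ⊔ ℓm) where
      field
        ⋆-bilinear : ∀ a → IsBilinear (λ x y → x ⋆[ a ] y)
        ⋆-assoc    : ∀ (b a a′ a″ a‴ : Fin γ) → a ≤ b → a′ ≤ b → a″ ≤ b → a‴ ≤ b →
                     ∀ x y z →
                       ((x ⋆[ a ] y) ⋆[ b ] z)  ≈ᴹ ((x ⋆[ b ] y) ⋆[ a′ ] z)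
                     × ((x ⋆[ b ] y) ⋆[ a′ ] z) ≈ᴹ (x ⋆[ a″ ] (y ⋆[ b ] z))
                     × (x ⋆[ a″ ] (y ⋆[ b ] z)) ≈ᴹ (x ⋆[ b ] (y ⋆[ a‴ ] z))

    record IsPluriassociative (γ : ℕ)
             (_⊣[_]_ _⊢[_]_ : Carrierᴹ → Fin γ → Carrierᴹ → Carrierᴹ) : Set (k ⊔ m ⊔ ℓm) where
      field
        ⊣-bilinear : ∀ a → IsBilinear (λ x y → x ⊣[ a ] y)
        ⊢-bilinear : ∀ a → IsBilinear (λ x y → x ⊢[ a ] y)
        ⊢-⊣-assoc  : ∀ (a a′ : Fin γ) x y z →
                     ((x ⊢[ a′ ] y) ⊣[ a ] z) ≈ᴹ (x ⊢[ a′ ] (y ⊣[ a ] z))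
        ⊣-inner    : ∀ (a a′ : Fin γ) x y z →
                     ((x ⊣[ a ↑ a′ ] y) ⊣[ a ] z) ≈ᴹ (x ⊣[ a ] (y ⊢[ a′ ] z))
        ⊢-inner    : ∀ (a a′ : Fin γ) x y z →
                     ((x ⊣[ a′ ] y) ⊢[ a ] z) ≈ᴹ (x ⊢[ a ] (y ⊢[ a ↑ a′ ] z))
        ⊣-assoc    : ∀ (a a′ : Fin γ) x y z →
                     ((x ⊣[ a ] y) ⊣[ a ↑ a′ ] z) ≈ᴹ (x ⊣[ a ] (y ⊣[ a′ ] z))
        ⊢-assoc    : ∀ (a a′ : Fin γ) x y z →
                     ((x ⊢[ a′ ] y) ⊢[ a ] z) ≈ᴹ (x ⊢[ a ↑ a′ ] (y ⊢[ a ] z))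

module _ (K : HeytingField k ℓ₁ ℓ₂) (γ : ℕ) where

  record MultiassociativeAlgebra (m ℓm : Level) : Set (k ⊔ ℓ₁ ⊔ lsuc (m ⊔ ℓm)) where
    field
      vectorSpace : VectorSpace K m ℓm

    open Module vectorSpace public using (Carrierᴹ; _≈ᴹ_)

    field
      _⋆[_]_             : Carrierᴹ → Fin γ → Carrierᴹ → Carrierᴹ
      isMultiassociative : IsMultiassociative {K = K} vectorSpace γ _⋆[_]_

    open IsMultiassociative isMultiassociative public

module _ {K : HeytingField k ℓ₁ ℓ₂} {γ : ℕ} where

  record IsMultiassociativeMorphism
           (A : MultiassociativeAlgebra K γ m ℓm) (B : MultiassociativeAlgebra K γ n ℓn)
           (f : MultiassociativeAlgebra.Carrierᴹ A → MultiassociativeAlgebra.Carrierᴹ B)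
           : Set (k ⊔ m ⊔ ℓm ⊔ ℓn) where
    private
      module A = MultiassociativeAlgebra A
      module B = MultiassociativeAlgebra B
    field
      linear : IsLinear {K = K} A.vectorSpace B.vectorSpace f
      ⋆-homo : ∀ (a : Fin γ) x y → f (x A.⋆[ a ] y) B.≈ᴹ (f x B.⋆[ a ] f y)

module _ (K : HeytingField k ℓ₁ ℓ₂) (γ : ℕ) where

  record MultiprojectionAlgebra (m ℓm : Level) : Set (k ⊔ ℓ₁ ⊔ lsuc (m ⊔ ℓm)) where
    field
      multiassociativeAlgebra : MultiassociativeAlgebra K γ m ℓm

    open MultiassociativeAlgebra multiassociativeAlgebra public

    field
      π                : Fin γ → Carrierᴹ → Carrierᴹ
      π-isEndomorphism : ∀ a → IsMultiassociativeMorphism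
                                 multiassociativeAlgebra multiassociativeAlgebra (π a)
      π-∘              : ∀ (a a′ : Fin γ) x → π a (π a′ x) ≈ᴹ π (a ↑ a′) x

    _⊣[_]_ : Carrierᴹ → Fin γ → Carrierᴹ → Carrierᴹ
    x ⊣[ a ] y = x ⋆[ a ] π a y

    _⊢[_]_ : Carrierᴹ → Fin γ → Carrierᴹ → Carrierᴹ
    x ⊢[ a ] y = π a x ⋆[ a ] y

{-# OPTIONS --safe #-}
-- A twofold ⋆-product depends only on the maximum of its two indices: (x ⋆[ p ] y) ⋆[ q ] z and
-- x ⋆[ r ] (y ⋆[ s ] z) agree as soon as p ↑ q ≡ r ↑ s. Pushing the π's inside the products and
-- merging them with π a ∘ π a′ = π (a ↑ a′) turns each pluriassociativity relation into such an
-- identity.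
module Submission where

open import Defs
open import Algebra.Apartness.Bundles using (HeytingField)
import Algebra.Construct.NaturalChoice.Max as Max
open import Algebra.Module.Bundles using (Module)
open import Algebra.Module.Morphism.Construct.Composition using (isModuleHomomorphism)
open import Algebra.Module.Morphism.Structures using (module IsModuleHomomorphism)
open import Data.Fin.Base using (Fin; _≤_)
open import Data.Fin.Properties using (≤-refl; ≤-totalOrder)
open import Data.Nat.Base using (ℕ)
open import Data.Product.Base using (_,_)
open import Data.Sum.Base using (_⊎_; inj₁; inj₂)
open import Level using (Level)
open import Relation.Binary.PropositionalEquality using (_≡_; refl; sym; trans; cong)
import Relation.Binary.Reasoning.Setoid as SetoidReasoning

private
  variable
    k ℓ₁ ℓ₂ m ℓm : Level
    γ : ℕ

module _ {γ : ℕ} where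
  open Max (≤-totalOrder γ) public
    using ()
    renaming ( ⊔-sel to ↑-sel; ⊔-comm to ↑-comm; ⊔-assoc to ↑-assoc; ⊔-idem to ↑-idem
             ; x≤x⊔y to a≤a↑a′; x≤y⊔x to a′≤a↑a′ )

-- Used to match index maxima in the relations where one operation is already indexed by `a ↑ a′`.
↑-absorbˡ : (a a′ : Fin γ) → a ↑ (a ↑ a′) ≡ a ↑ a′
↑-absorbˡ a a′ = trans (sym (↑-assoc a a a′)) (cong (_↑ a′) (↑-idem a))

↑-absorbʳ : (a a′ : Fin γ) → (a ↑ a′) ↑ a ≡ a ↑ a′
↑-absorbʳ a a′ = trans (↑-comm (a ↑ a′) a) (↑-absorbˡ a a′)

module Multiassociative {K : HeytingField k ℓ₁ ℓ₂} (A : MultiassociativeAlgebra K γ m ℓm) where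
  open MultiassociativeAlgebra A
  open Module vectorSpace using (≈ᴹ-sym; ≈ᴹ-trans; ≈ᴹ-setoid)

  ⋆-congˡ : ∀ a x {y z} → y ≈ᴹ z → x ⋆[ a ] y ≈ᴹ x ⋆[ a ] z
  ⋆-congˡ a x = IsModuleHomomorphism.⟦⟧-cong (IsBilinear.linearʳ (⋆-bilinear a) x)

  ⋆-congʳ : ∀ a z {x y} → x ≈ᴹ y → x ⋆[ a ] z ≈ᴹ y ⋆[ a ] z
  ⋆-congʳ a z = IsModuleHomomorphism.⟦⟧-cong (IsBilinear.linearˡ (⋆-bilinear a) z)

  -- The hypotheses characterise `b` as the maximum of `p` and `q`. Splitting on which of the two
  -- attains it puts `b` at one node, and the first equality of `⋆-assoc` lets the index at the
  -- other node be raised to `b`.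
  ⋆-leftComb-max : ∀ {b p q} → p ≤ b → q ≤ b → b ≡ p ⊎ b ≡ q → ∀ x y z →
                   (x ⋆[ p ] y) ⋆[ q ] z ≈ᴹ (x ⋆[ b ] y) ⋆[ b ] z
  ⋆-leftComb-max {b} {q = q} _ q≤b (inj₁ refl) x y z
    with e , _ ← ⋆-assoc b b q b b ≤-refl q≤b ≤-refl ≤-refl x y z = ≈ᴹ-sym e
  ⋆-leftComb-max {b} {p} p≤b _ (inj₂ refl) x y z
    with e , _ ← ⋆-assoc b p b b b p≤b ≤-refl ≤-refl ≤-refl x y z = e

  -- The second equality of `⋆-assoc` moves the brackets and suffices when the inner index `s` is
  -- the maximum. When the outer index `r` is, the third equality then lowers the inner index from
  -- `b` to `s`.
  ⋆-rightComb-max : ∀ {b r s} → r ≤ b → s ≤ b → b ≡ r ⊎ b ≡ s → ∀ x y z →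
                    (x ⋆[ b ] y) ⋆[ b ] z ≈ᴹ x ⋆[ r ] (y ⋆[ s ] z)
  ⋆-rightComb-max {b} {s = s} _ s≤b (inj₁ refl) x y z
    with _ , e , e′ ← ⋆-assoc b b b b s ≤-refl ≤-refl ≤-refl s≤b x y z = ≈ᴹ-trans e e′
  ⋆-rightComb-max {b} {r} r≤b _ (inj₂ refl) x y z
    with _ , e , _ ← ⋆-assoc b b b r b ≤-refl ≤-refl r≤b ≤-refl x y z = e

  -- Both sides reduce to the left comb that carries the common maximum at both nodes.
  ⋆-reassoc : ∀ {p q r s} → p ↑ q ≡ r ↑ s → ∀ x y z →
              (x ⋆[ p ] y) ⋆[ q ] z ≈ᴹ x ⋆[ r ] (y ⋆[ s ] z)
  ⋆-reassoc {p} {q} {r} {s} eq x y z = begin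
    (x ⋆[ p ] y) ⋆[ q ] z          ≈⟨ ⋆-leftComb-max (a≤a↑a′ p q) (a′≤a↑a′ p q) (↑-sel p q) x y z ⟩
    (x ⋆[ p ↑ q ] y) ⋆[ p ↑ q ] z  ≡⟨ cong (λ b → (x ⋆[ b ] y) ⋆[ b ] z) eq ⟩
    (x ⋆[ r ↑ s ] y) ⋆[ r ↑ s ] z  ≈⟨ ⋆-rightComb-max (a≤a↑a′ r s) (a′≤a↑a′ r s) (↑-sel r s) x y z ⟩
    x ⋆[ r ] (y ⋆[ s ] z)          ∎
    where open SetoidReasoning ≈ᴹ-setoid

module Multiprojection {K : HeytingField k ℓ₁ ℓ₂} (M : MultiprojectionAlgebra K γ m ℓm) where
  open MultiprojectionAlgebra M
  open Multiassociative multiassociativeAlgebra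
  open Module vectorSpace using (≈ᴹ-trans; ≈ᴹ-setoid)
  open SetoidReasoning ≈ᴹ-setoid
  private
    module π a = IsMultiassociativeMorphism (π-isEndomorphism a)

  -- The endomorphism `π a` reaches both factors; on `y` it meets the `π a′` hidden in `⊣[ a′ ]` and
  -- merges with it.
  π-⊣ : ∀ a a′ x y → π a (x ⊣[ a′ ] y) ≈ᴹ π a x ⋆[ a′ ] π (a ↑ a′) y
  π-⊣ a a′ x y = ≈ᴹ-trans (π.⋆-homo a a′ x (π a′ y)) (⋆-congˡ a′ (π a x) (π-∘ a a′ y))

  π-⊢ : ∀ a a′ x y → π a (x ⊢[ a′ ] y) ≈ᴹ π (a ↑ a′) x ⋆[ a′ ] π a y
  π-⊢ a a′ x y = ≈ᴹ-trans (π.⋆-homo a a′ (π a′ x) y) (⋆-congʳ a′ (π a y) (π-∘ a a′ x))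

  isPluriassociative : IsPluriassociative {K = K} vectorSpace γ _⊣[_]_ _⊢[_]_
  isPluriassociative = record
    { ⊣-bilinear = λ a → record
      { linearˡ = λ y → IsBilinear.linearˡ (⋆-bilinear a) (π a y)
      -- In the argument under the projection, the map is `π a` followed by a linear multiplication
      -- map.
      ; linearʳ = λ x → isModuleHomomorphism ≈ᴹ-trans (π.linear a) (IsBilinear.linearʳ (⋆-bilinear a) x)
      }
    ; ⊢-bilinear = λ a → record
      { linearˡ = λ y → isModuleHomomorphism ≈ᴹ-trans (π.linear a) (IsBilinear.linearˡ (⋆-bilinear a) y)
      ; linearʳ = λ x → IsBilinear.linearʳ (⋆-bilinear a) (π a x)
      }
    -- The projections fall only on the outer factors `x` and `z`, so none has to be pushed through
    -- a product, and both sides have the indices `a′`, `a` in the same order.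
    ; ⊢-⊣-assoc = λ a a′ x y z → ⋆-reassoc refl (π a′ x) y (π a z)
    ; ⊣-inner = λ a a′ x y z → begin
        -- Only the right-hand side applies a projection to a product, so the comb is reassociated
        -- first and `π-⊢` is then used backwards.
        (x ⊣[ a ↑ a′ ] y) ⊣[ a ] z                 ≈⟨ ⋆-reassoc (↑-absorbʳ a a′) x (π (a ↑ a′) y) (π a z) ⟩
        x ⋆[ a ] (π (a ↑ a′) y ⋆[ a′ ] π a z)      ≈⟨ ⋆-congˡ a x (π-⊢ a a′ y z) ⟨
        x ⊣[ a ] (y ⊢[ a′ ] z)                     ∎
    ; ⊢-inner = λ a a′ x y z → begin
        -- Here the projected product is on the left, so `π a` is distributed before reassociating.
        (x ⊣[ a′ ] y) ⊢[ a ] z                     ≈⟨ ⋆-congʳ a z (π-⊣ a a′ x y) ⟩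
        (π a x ⋆[ a′ ] π (a ↑ a′) y) ⋆[ a ] z
          ≈⟨ ⋆-reassoc (trans (↑-comm a′ a) (sym (↑-absorbˡ a a′))) (π a x) (π (a ↑ a′) y) z ⟩
        x ⊢[ a ] (y ⊢[ a ↑ a′ ] z)                 ∎
    ; ⊣-assoc = λ a a′ x y z → begin
        (x ⊣[ a ] y) ⊣[ a ↑ a′ ] z                 ≈⟨ ⋆-reassoc (↑-absorbˡ a a′) x (π a y) (π (a ↑ a′) z) ⟩
        x ⋆[ a ] (π a y ⋆[ a′ ] π (a ↑ a′) z)      ≈⟨ ⋆-congˡ a x (π-⊣ a a′ y z) ⟨
        x ⊣[ a ] (y ⊣[ a′ ] z)                     ∎
    ; ⊢-assoc = λ a a′ x y z → begin
        (x ⊢[ a′ ] y) ⊢[ a ] z                     ≈⟨ ⋆-congʳ a z (π-⊢ a a′ x y) ⟩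
        (π (a ↑ a′) x ⋆[ a′ ] π a y) ⋆[ a ] z
          ≈⟨ ⋆-reassoc (trans (↑-comm a′ a) (sym (↑-absorbʳ a a′))) (π (a ↑ a′) x) (π a y) z ⟩
        x ⊢[ a ↑ a′ ] (y ⊢[ a ] z)                 ∎
    }

theorem3p3p2 : ∀ {k ℓ₁ ℓ₂ m ℓm : Level} (K : HeytingField k ℓ₁ ℓ₂) → CharacteristicZero K →
    (γ : ℕ) (M : MultiprojectionAlgebra K γ m ℓm) →
    let open MultiprojectionAlgebra M in
    IsPluriassociative {K = K} vectorSpace γ _⊣[_]_ _⊢[_]_
theorem3p3p2 K _ γ M = Multiprojection.isPluriassociative M
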